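{- Let $q$ be a prime power, let $m\ge 1$ and $n\ge 3$ be integers, let $h$ be a non-negative integer, and let $X$ be a vector space of dimension $n$ over $\mathbb{F}_{q^m}$. Let $\mathcal{D}=\{\langle x\rangle_{\mathbb{F}_{q^m}} : x\in X\setminus\{0\}\}$. If $U$ is a $(\mathcal{D},h)$-evasive $\mathbb{F}_q$-subspace of $X$ having $\mathbb{F}_q$-dimension $(n-2)m+h+1$, then $L_U$ is a linear $2$-cutting blocking set in $X$.
   Context: An $\mathbb{F}_q$-subspace $U\le X$ is $(\mathcal{D},h)$-evasive if $\dim_{\mathbb{F}_q}(U\cap S)\leq h$ for all $S\in\mathcal{D}$. For an $\mathbb{F}_q$-subspace $U\le X$, the $\mathbb{F}_q$-linear set defined by $U$ is $L_U=\{\langle u\rangle_{\mathbb{F}_{q^m}}: u\in U\setminus\{0\}\}$, and its rank is $\dim_{\mathbb{F}_q}(U)$. For a positive integer $r<n$, an $r$-blocking set in $X$ is a set $\mathcal{B}$ of one-dimensional $\mathbb{F}_{q^m}$-subspaces of $X$ such that every $(n-r)$-dimensional $\mathbb{F}_{q^m}$-subspace $\mathcal{S}$ of $X$ contains at least one element of $\mathcal{B}$. An $r$-blocking set $\mathcal{B}$ is $(n-r)$-cutting if for every pair $\mathcal{S},\mathcal{S}'$ of $(n-r)$-dimensional $\mathbb{F}_{q^m}$-subspaces of $X$ one has $\{B\in\mathcal{B}: B\leq\mathcal{S}\}\subseteq\{B\in\mathcal{B}: B\leq\mathcal{S}'\}$ if and only if $\mathcal{S}=\mathcal{S}'$. A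 linear $2$-cutting blocking set in $X$ is an $\mathbb{F}_q$-linear set $L_U$ that is an $(n-2)$-blocking set and is $2$-cutting. -}

module Defs where

open import Algebra.Bundles using (Ring; CommutativeRing)
open import Algebra.Module.Bundles using (LeftModule)
open import Algebra.Morphism.Structures using (module RingMorphisms)
open import Data.Fin.Base using (Fin)
open import Data.Nat.Base using (ℕ; _≤_; _<_; _∸_; _^_)
open import Data.Nat.Primality using (Prime)
open import Data.Product.Base using (_×_; _,_; ∃; ∃₂)
open import Data.Vec.Functional using (Vector)
open import Function.Bundles using (Inverse; _⇔_)
open import Level using (Level) renaming (suc to lsuc; _⊔_ to _⊔ˡ_)
open import Relation.Binary.Bundles using (Setoid)
open import Relation.Binary.Definitions using (_Respects_)
import Relation.Binary.PropositionalEquality as ≡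
open import Relation.Nullary.Negation using (¬_)
open import Relation.Unary using (Pred; _∈_; _⊆_; _≐_; _∩_)
import Algebra.Definitions.RawMonoid as RawMonoidDefs

IsPrimePower : ℕ → Set
IsPrimePower q = ∃₂ λ p k → Prime p × 1 ≤ k × q ≡.≡ p ^ k

HasCardinality : ∀ {a ℓ} → Setoid a ℓ → ℕ → Set (a ⊔ˡ ℓ)
HasCardinality S n = Inverse S (≡.setoid (Fin n))

-- Only finite fields are considered below; their equality is decidable, so
-- "nonzero" is the negation of ≈ and no separate apartness is carried.
record Field (ℓ : Level) : Set (lsuc ℓ) where
  field
    commutativeRing : CommutativeRing ℓ ℓ
  open CommutativeRing commutativeRing public
  field
    0≉1     : ¬ 0# ≈ 1#
    inverse : ∀ x → ¬ x ≈ 0# → ∃ λ y → x * y ≈ 1#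

record FieldExtension (ℓ : Level) : Set (lsuc ℓ) where
  field
    base top : Field ℓ
  module F = Field base
  module K = Field top
  open RingMorphisms F.rawRing K.rawRing using (IsRingMonomorphism)
  field
    embed              : F.Carrier → K.Carrier
    isRingMonomorphism : IsRingMonomorphism embed

module _ {ℓ : Level} {R : Ring ℓ ℓ} (M : LeftModule R ℓ ℓ) where
  open Ring R using (Carrier; _≈_; 0#)
  open LeftModule M

  record IsSubspace {p : Level} (W : Pred Carrierᴹ p) : Set (ℓ ⊔ˡ p) where
    field
      resp       : W Respects _≈ᴹ_
      0ᴹ∈        : 0ᴹ ∈ W
      +ᴹ-closed  : ∀ {x y} → x ∈ W → y ∈ W → x +ᴹ y ∈ W
      *ₗ-closed  : ∀ c {x} → x ∈ W → c *ₗ x ∈ W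

  lincomb : ∀ {d} → Vector Carrier d → Vector Carrierᴹ d → Carrierᴹ
  lincomb c b = RawMonoidDefs.sum +ᴹ-rawMonoid λ i → c i *ₗ b i

  record IsBasis {p : Level} (W : Pred Carrierᴹ p) {d : ℕ} (b : Vector Carrierᴹ d) : Set (ℓ ⊔ˡ p) where
    field
      contained   : ∀ i → b i ∈ W
      independent : ∀ c → lincomb c b ≈ᴹ 0ᴹ → ∀ i → c i ≈ 0#
      spanning    : ∀ {x} → x ∈ W → ∃ λ c → x ≈ᴹ lincomb c b

  HasDim : {p : Level} → Pred Carrierᴹ p → ℕ → Set (ℓ ⊔ˡ p)
  HasDim W d = ∃ λ (b : Vector Carrierᴹ d) → IsBasis W b

  HasDim≤ : {p : Level} → Pred Carrierᴹ p → ℕ → Set (ℓ ⊔ˡ p)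
  HasDim≤ W h = ∃ λ d → HasDim W d × d ≤ h

  IsSubspaceOfDim : {p : Level} → ℕ → Pred Carrierᴹ p → Set (ℓ ⊔ˡ p)
  IsSubspaceOfDim k W = IsSubspace W × HasDim W k

  ⟨_⟩ : Carrierᴹ → Pred Carrierᴹ ℓ
  ⟨ x ⟩ y = ∃ λ c → y ≈ᴹ c *ₗ x

module _ {ℓ : Level} (E : FieldExtension ℓ) where
  open FieldExtension E

  restrictScalars : LeftModule K.ring ℓ ℓ → LeftModule F.ring ℓ ℓ
  restrictScalars X = record
    { Carrierᴹ = Carrierᴹ
    ; _≈ᴹ_ = _≈ᴹ_
    ; _+ᴹ_ = _+ᴹ_
    ; _*ₗ_ = λ c x → embed c *ₗ x
    ; 0ᴹ = 0ᴹ
    ; -ᴹ_ = -ᴹ_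
    ; isLeftModule = record
      { isLeftSemimodule = record
        { +ᴹ-isCommutativeMonoid = +ᴹ-isCommutativeMonoid
        ; isPreleftSemimodule = record
          { *ₗ-cong = λ c≈d x≈y → *ₗ-cong (ι.⟦⟧-cong c≈d) x≈y
          ; *ₗ-zeroˡ = λ x → ≈ᴹ-trans (*ₗ-congʳ ι.0#-homo) (*ₗ-zeroˡ x)
          ; *ₗ-distribʳ = λ x c d → ≈ᴹ-trans (*ₗ-congʳ (ι.+-homo c d)) (*ₗ-distribʳ x (embed c) (embed d))
          ; *ₗ-identityˡ = λ x → ≈ᴹ-trans (*ₗ-congʳ ι.1#-homo) (*ₗ-identityˡ x)
          ; *ₗ-assoc = λ c d x → ≈ᴹ-trans (*ₗ-congʳ (ι.*-homo c d)) (*ₗ-assoc (embed c) (embed d) x)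
          ; *ₗ-zeroʳ = λ c → *ₗ-zeroʳ (embed c)
          ; *ₗ-distribˡ = λ c → *ₗ-distribˡ (embed c)
          }
        }
      ; -ᴹ‿cong = -ᴹ‿cong
      ; -ᴹ‿inverse = -ᴹ‿inverse
      }
    }
    where
    open LeftModule X
    module ι = RingMorphisms.IsRingMonomorphism isRingMonomorphism

-- A subspace of X is a predicate, considered up to ≐; a collection of subspaces
-- is therefore a predicate on predicates.
module _ {ℓ : Level} (E : FieldExtension ℓ) (X : LeftModule (FieldExtension.K.ring E) ℓ ℓ) where
  open LeftModule X

  private
    X∣F : LeftModule (FieldExtension.F.ring E) ℓ ℓ
    X∣F = restrictScalars E X

  IsEvasive : Pred (Pred Carrierᴹ ℓ) ℓ → ℕ → Pred Carrierᴹ ℓ → Set (lsuc ℓ)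
  IsEvasive 𝒟 h U = ∀ {S} → S ∈ 𝒟 → HasDim≤ X∣F (U ∩ S) h

  points : Pred (Pred Carrierᴹ ℓ) ℓ
  points S = ∃ λ x → ¬ x ≈ᴹ 0ᴹ × S ≐ ⟨_⟩ X x

  linearSet : Pred Carrierᴹ ℓ → Pred (Pred Carrierᴹ ℓ) ℓ
  linearSet U S = ∃ λ u → u ∈ U × ¬ u ≈ᴹ 0ᴹ × S ≐ ⟨_⟩ X u

  record IsPointSet {c : Level} (ℬ : Pred (Pred Carrierᴹ ℓ) c) : Set (lsuc ℓ ⊔ˡ c) where
    field
      resp      : ℬ Respects _≐_
      dimension : ∀ {P} → P ∈ ℬ → IsSubspaceOfDim X 1 P

  -- Here and below n stands for the dimension of X.
  record IsBlockingSet {c : Level} (n r : ℕ) (ℬ : Pred (Pred Carrierᴹ ℓ) c) : Set (lsuc ℓ ⊔ˡ c) where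
    field
      0<r        : 0 < r
      r<n        : r < n
      isPointSet : IsPointSet ℬ
      blocks     : ∀ {S : Pred Carrierᴹ ℓ} → IsSubspaceOfDim X (n ∸ r) S → ∃ λ P → P ∈ ℬ × P ⊆ S

  pointsIn : {c : Level} → Pred (Pred Carrierᴹ ℓ) c → Pred Carrierᴹ ℓ → Pred (Pred Carrierᴹ ℓ) (ℓ ⊔ˡ c)
  pointsIn ℬ S P = P ∈ ℬ × P ⊆ S

  IsCutting : {c : Level} → ℕ → Pred (Pred Carrierᴹ ℓ) c → Set (lsuc ℓ ⊔ˡ c)
  IsCutting k ℬ = ∀ {S S′ : Pred Carrierᴹ ℓ} → IsSubspaceOfDim X k S → IsSubspaceOfDim X k S′ →
    (pointsIn ℬ S ⊆ pointsIn ℬ S′) ⇔ (S ≐ S′)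

  IsLinearSet : {c : Level} → Pred (Pred Carrierᴹ ℓ) c → Set (lsuc ℓ ⊔ˡ c)
  IsLinearSet ℬ = ∃ λ (U : Pred Carrierᴹ ℓ) → IsSubspace X∣F U × ℬ ≐ linearSet U

  record IsLinear2CuttingBlockingSet {c : Level} (n : ℕ) (ℬ : Pred (Pred Carrierᴹ ℓ) c) : Set (lsuc ℓ ⊔ˡ c) where
    field
      isLinearSet   : IsLinearSet ℬ
      isBlockingSet : IsBlockingSet n (n ∸ 2) ℬ
      isCutting     : IsCutting 2 ℬ

{-# OPTIONS --safe #-}

-- Everything is done by counting instead of by linear algebra. If U and S are
-- subgroups with more than |X| · e pairs (u , s), then some fibre of the sum
-- map (u , s) ↦ u + s has more than e elements, and differences within a fibre
-- lie in U ∩ S; so U ∩ S is not contained in any W with |U ∩ W| ≤ e. For U as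
-- in the theorem, S a K-plane and W a point, |U| · |S| = q^(nm + h + 1) and
-- e ≤ q^h. Hence U ∩ S contains some u ≠ 0, and then some v outside ⟨ u ⟩. A
-- K-plane S′ containing all points of L_U in S contains u and v, so S ∩ S′
-- contains two independent vectors and S = S ∩ S′ = S′.
module Submission where

open import Defs
open import Algebra.Bundles using (Group; Ring)
open import Algebra.Module.Bundles using (LeftModule)
import Algebra.Module.Properties.LeftModule as LeftModuleProperties
import Algebra.Properties.CommutativeMonoid.Sum as SumProperties
import Algebra.Properties.Group as GroupProperties
open import Data.Fin.Base using (Fin; zero; suc; combine; remQuot; funToFin; finToFun)
open import Data.Fin.Properties using (_≟_; any?; all?; combine-injective; combine-remQuot; funToFin-finToFin; finToFun-funToFin; injective⇒≤; inj⇒≟)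
open import Data.Nat.Base using (ℕ; zero; suc; _≤_; _<_; _+_; _*_; _∸_; _^_; z<s; s<s; s≤s; z≤n)
open import Data.Nat.Properties using (≤-reflexive; <⇒≤; <⇒≱; ^-*-assoc; ^-distribˡ-+-*; ^-monoʳ-<; +-monoʳ-≤; +-monoʳ-<; m∸[m∸n]≡n; m<n⇒0<n∸m; ∸-monoʳ-<; module ≤-Reasoning)
open import Data.Nat.Solver using (module +-*-Solver)
open import Data.Product.Base using (_×_; _,_; ∃; proj₁; proj₂)
open import Data.Unit.Base using (tt)
open import Data.Vec.Functional using (Vector; []; _∷_)
open import Function.Base using (_∘_)
open import Function.Bundles using (Inverse; Injection; mk⇔)
open import Function.Properties.Inverse using (Inverse⇒Injection)
open import Level using (Level; _⊔_)
open import Relation.Binary.Bundles using (Setoid)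
open import Relation.Binary.Definitions using () renaming (Decidable to Decidable₂)
open import Relation.Binary.PropositionalEquality as ≡ using (_≡_)
open import Relation.Nullary.Decidable using (Dec; yes; no; ¬?; map′; decidable-stable)
open import Relation.Nullary.Negation using (¬_; contradiction)
open import Relation.Unary using (Pred; Decidable; _∈_; _∉_; _⊆_; _≐_; _∩_) renaming (U to Whole)
open import Relation.Unary.Properties using (≐-sym; ≐-trans; ≐-refl)

private variable
  a p r v w ℓ : Level

-- Cardinality bounds for predicates on a setoid

module _ (A : Setoid a ℓ) where
  open Setoid A using (Carrier; _≈_)

  -- Codes are assigned to membership proofs, so two proofs for the same element may get different
  -- codes. This admits coordinates chosen by a `spanning` property.
  record AtMost (P : Pred Carrier p) (n : ℕ) : Set (a ⊔ ℓ ⊔ p) where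
    field
      code      : ∀ {x} → x ∈ P → Fin n
      injective : ∀ {x y} (x∈P : x ∈ P) (y∈P : y ∈ P) → code x∈P ≡ code y∈P → x ≈ y

  record AtLeast (P : Pred Carrier p) (n : ℕ) : Set (a ⊔ ℓ ⊔ p) where
    field
      element   : Fin n → Carrier
      contained : ∀ i → element i ∈ P
      injective : ∀ {i j} → element i ≈ element j → i ≡ j

-- The representative of `i` is the first index found by a search that depends only on the value
-- `f i`, so it is constant on each fibre.
fibre-representative : ∀ {m n} (f : Fin m → Fin n) → ∃ λ (rep : Fin m → Fin m) →
  (∀ i → f (rep i) ≡ f i) × (∀ {i j} → f i ≡ f j → rep i ≡ rep j)
fibre-representative {m} {n} f =
  (λ i → proj₁ (choose (found i))) , (λ i → proj₂ (choose (found i))) , λ fi≡fj → unique fi≡fj (found _) (found _)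
  where
  Fibre : Fin n → Set
  Fibre y = ∃ λ i → f i ≡ y

  choose : ∀ {y} → Fibre y → Fibre y
  choose {y} i∈f⁻¹y with any? (λ i → f i ≟ y)
  ... | yes first = first
  ... | no  empty = contradiction i∈f⁻¹y empty

  found : ∀ i → Fibre (f i)
  found i = i , ≡.refl

  unique : ∀ {y z} → y ≡ z → (i∈f⁻¹y : Fibre y) (j∈f⁻¹z : Fibre z) → proj₁ (choose i∈f⁻¹y) ≡ proj₁ (choose j∈f⁻¹z)
  unique {y} ≡.refl i∈f⁻¹y j∈f⁻¹y with any? (λ i → f i ≟ y)
  ... | yes _     = ≡.refl
  ... | no  empty = contradiction i∈f⁻¹y empty

-- Pigeonhole principle for products in a group

module _ (G : Group a ℓ) where
  open Group G
  open GroupProperties G using (∙-cancelˡ; ∙-cancelʳ; \\-leftDividesˡ; //-rightDividesˡ)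
  open import Relation.Binary.Reasoning.Setoid setoid

  \\≈// : ∀ {x x′ y y′} → x ∙ y ≈ x′ ∙ y′ → x′ \\ x ≈ y′ // y
  \\≈// {x} {x′} {y} {y′} xy≈x′y′ = ∙-cancelʳ y _ _ (∙-cancelˡ x′ _ _ (begin
    x′ ∙ ((x′ \\ x) ∙ y) ≈⟨ assoc _ _ _ ⟨
    x′ ∙ (x′ \\ x) ∙ y   ≈⟨ ∙-congʳ (\\-leftDividesˡ x′ x) ⟩
    x ∙ y                ≈⟨ xy≈x′y′ ⟩
    x′ ∙ y′              ≈⟨ ∙-congˡ (//-rightDividesˡ y y′) ⟨
    x′ ∙ ((y′ // y) ∙ y) ∎))

  -- If every difference `diff i` lay in `W`, then recording the product of a pair together with its
  -- difference would inject `b * c` pairs into `d * e` codes. `V` is any set that contains all the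
  -- products.
  ∩-escapes : {P : Pred Carrier p} {R : Pred Carrier r} {V : Pred Carrier v} {W : Pred Carrier w} →
    (∀ {x y} → x ∈ P → y ∈ P → x \\ y ∈ P) →
    (∀ {x y z} → x ∈ R → y ∈ R → z ≈ x // y → z ∈ R) →
    (∀ {x y} → x ∈ P → y ∈ R → x ∙ y ∈ V) →
    Decidable W → ∀ {b c d e} →
    AtLeast setoid P b → AtLeast setoid R c → AtMost setoid V d → AtMost setoid (P ∩ W) e →
    d * e < b * c → ∃ λ x → x ∈ P × x ∈ R × x ∉ W
  ∩-escapes {P = P} {R} {V} {W} P-closed R-closed PR⊆V W? {b} {c} {d} {e} b≤P c≤R V≤d PW≤e de<bc =
    conclude (any? (¬? ∘ W? ∘ diff))
    where
    module P = AtLeast b≤P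
    module R = AtLeast c≤R
    module V = AtMost V≤d
    module PW = AtMost PW≤e

    left : Fin (b * c) → Carrier
    left i = P.element (proj₁ (remQuot c i))

    right : Fin (b * c) → Carrier
    right i = R.element (proj₂ (remQuot {b} c i))

    left∈P : ∀ i → left i ∈ P
    left∈P i = P.contained _

    product∈V : ∀ i → left i ∙ right i ∈ V
    product∈V i = PR⊆V (left∈P i) (R.contained _)

    f : Fin (b * c) → Fin d
    f i = V.code (product∈V i)

    rep : Fin (b * c) → Fin (b * c)
    rep = proj₁ (fibre-representative f)

    diff : Fin (b * c) → Carrier
    diff i = left (rep i) \\ left i

    diff∈P : ∀ i → diff i ∈ P
    diff∈P i = P-closed (left∈P _) (left∈P i)

    diff∈R : ∀ i → diff i ∈ R
    -- The pairs `i` and `rep i` have the same code, hence equal products; so the left quotient of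
    -- their `P`-components is also a right quotient of their `R`-components.
    diff∈R i = R-closed (R.contained _) (R.contained _)
      (\\≈// (V.injective (product∈V i) (product∈V (rep i)) (≡.sym (proj₁ (proj₂ (fibre-representative f)) i))))

    module _ (diff∈W : ∀ i → diff i ∈ W) where
      -- A pair is determined by its sum and its difference from the representative of its fibre.
      g : Fin (b * c) → Fin (d * e)
      g i = combine (f i) (PW.code (diff∈P i , diff∈W i))

      g-injective : ∀ {i j} → g i ≡ g j → i ≡ j
      g-injective {i} {j} gi≡gj = ≡.trans (≡.sym (combine-remQuot {b} c i))
        (≡.trans (≡.cong₂ combine (P.injective left≈) (R.injective right≈)) (combine-remQuot {b} c j))
        where
        components : f i ≡ f j × PW.code (diff∈P i , diff∈W i) ≡ PW.code (diff∈P j , diff∈W j)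
        components = combine-injective _ _ _ _ gi≡gj

        rep≡ : rep i ≡ rep j
        rep≡ = proj₂ (proj₂ (fibre-representative f)) (proj₁ components)

        diff≈ : left (rep j) \\ left i ≈ left (rep j) \\ left j
        -- The codes compare differences from `rep i` and from `rep j`; `rep≡` makes the two base
        -- points the same, so that it can be cancelled.
        diff≈ = ≡.subst (λ k → left k \\ left i ≈ diff j) rep≡ (PW.injective _ _ (proj₂ components))

        left≈ : left i ≈ left j
        left≈ = ∙-cancelˡ _ _ _ diff≈

        right≈ : right i ≈ right j
        right≈ = ∙-cancelˡ (left i) _ _
          (trans (V.injective (product∈V i) (product∈V j) (proj₁ components)) (∙-congʳ (sym left≈)))

    conclude : Dec (∃ λ i → diff i ∉ W) → ∃ λ x → x ∈ P × x ∈ R × x ∉ W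
    conclude (yes (i , i∉W)) = diff i , diff∈P i , diff∈R i , i∉W
    -- Decidability of `W` turns the failed search into membership of every difference in `W`.
    conclude (no  none)      = contradiction (injective⇒≤ (g-injective all∈W)) (<⇒≱ de<bc)
      where
      all∈W : ∀ i → diff i ∈ W
      all∈W i = decidable-stable (W? (diff i)) (λ i∉W → none (i , i∉W))

-- Subspaces and linear combinations

module _ {R : Ring ℓ ℓ} (M : LeftModule R ℓ ℓ) where
  open Ring R using (Carrier; _≈_; 0#; 1#; -_; _-_)
  private module R = Ring R
  open LeftModule M
  open SumProperties +ᴹ-commutativeMonoid using (sum-cong-≋; ∑-distrib-+; sum-replicate-zero)
  open GroupProperties R.+-group using (x∙y⁻¹≈ε⇒x≈y; //-rightDividesˡ)
  open import Relation.Binary.Reasoning.Setoid ≈ᴹ-setoid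

  Independent : ∀ {d} → Vector Carrierᴹ d → Set ℓ
  Independent b = ∀ c → lincomb M c b ≈ᴹ 0ᴹ → ∀ i → c i ≈ 0#

  -- `IsSubspace` does not list closure under negation; this identity yields it from closure under
  -- scalars.
  -1*ₗ : ∀ x → (- 1#) *ₗ x ≈ᴹ -ᴹ x
  -1*ₗ x = LeftModuleProperties.inverseʳ-uniqueᴹ M x _ (begin
    x +ᴹ (- 1#) *ₗ x         ≈⟨ +ᴹ-congʳ (*ₗ-identityˡ x) ⟨
    1# *ₗ x +ᴹ (- 1#) *ₗ x   ≈⟨ *ₗ-distribʳ x 1# (- 1#) ⟨
    (1# - 1#) *ₗ x           ≈⟨ *ₗ-congʳ (R.-‿inverseʳ 1#) ⟩
    0# *ₗ x                  ≈⟨ *ₗ-zeroˡ x ⟩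
    0ᴹ                       ∎)

  -- The bound for taking `W` to be zero in `∩-escapes`, which then produces a nonzero element. As
  -- `1` is `k ^ 0` by computation, this is also a bound with exponent zero.
  ∩0ᴹ-AtMost : (P : Pred Carrierᴹ p) → AtMost ≈ᴹ-setoid (P ∩ (_≈ᴹ 0ᴹ)) 1
  ∩0ᴹ-AtMost P = record
    { code      = λ _ → zero
    ; injective = λ (_ , x≈0) (_ , y≈0) _ → ≈ᴹ-trans x≈0 (≈ᴹ-sym y≈0)
    }

  ≐-IsSubspaceOfDim : {P : Pred Carrierᴹ p} {Q : Pred Carrierᴹ r} → P ≐ Q →
    ∀ {d} → IsSubspaceOfDim M d P → IsSubspaceOfDim M d Q
  ≐-IsSubspaceOfDim (P⊆Q , Q⊆P) (P-subspace , b , basis) =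
    record
      { resp      = λ x≈y x∈Q → P⊆Q (P.resp x≈y (Q⊆P x∈Q))
      ; 0ᴹ∈       = P⊆Q P.0ᴹ∈
      ; +ᴹ-closed = λ x∈Q y∈Q → P⊆Q (P.+ᴹ-closed (Q⊆P x∈Q) (Q⊆P y∈Q))
      ; *ₗ-closed = λ c x∈Q → P⊆Q (P.*ₗ-closed c (Q⊆P x∈Q))
      } ,
    b , record
      { contained   = λ i → P⊆Q (B.contained i)
      ; independent = B.independent
      ; spanning    = λ x∈Q → B.spanning (Q⊆P x∈Q)
      }
    where
    module P = IsSubspace P-subspace
    module B = IsBasis basis

  module _ {P : Pred Carrierᴹ p} (P-subspace : IsSubspace M P) where
    open IsSubspace P-subspace

    -ᴹ-closed : ∀ {x} → x ∈ P → -ᴹ x ∈ P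
    -ᴹ-closed x∈P = resp (-1*ₗ _) (*ₗ-closed (- 1#) x∈P)

    \\-closed : ∀ {x y} → x ∈ P → y ∈ P → Group._\\_ +ᴹ-group x y ∈ P
    \\-closed x∈P y∈P = +ᴹ-closed (-ᴹ-closed x∈P) y∈P

    //-closed : ∀ {x y z} → x ∈ P → y ∈ P → z ≈ᴹ Group._//_ +ᴹ-group x y → z ∈ P
    //-closed x∈P y∈P z≈x//y = resp (≈ᴹ-sym z≈x//y) (+ᴹ-closed x∈P (-ᴹ-closed y∈P))

    ⟨⟩-⊆ : ∀ {x} → x ∈ P → ⟨_⟩ M x ⊆ P
    ⟨⟩-⊆ x∈P (c , y≈cx) = resp (≈ᴹ-sym y≈cx) (*ₗ-closed c x∈P)

  ∩-isSubspace : {P : Pred Carrierᴹ p} {Q : Pred Carrierᴹ r} → IsSubspace M P → IsSubspace M Q → IsSubspace M (P ∩ Q)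
  ∩-isSubspace P Q = record
    { resp      = λ x≈y (x∈P , x∈Q) → P.resp x≈y x∈P , Q.resp x≈y x∈Q
    ; 0ᴹ∈       = P.0ᴹ∈ , Q.0ᴹ∈
    ; +ᴹ-closed = λ (x∈P , x∈Q) (y∈P , y∈Q) → P.+ᴹ-closed x∈P y∈P , Q.+ᴹ-closed x∈Q y∈Q
    ; *ₗ-closed = λ c (x∈P , x∈Q) → P.*ₗ-closed c x∈P , Q.*ₗ-closed c x∈Q
    }
    where
    module P = IsSubspace P
    module Q = IsSubspace Q

  ⟨⟩-isSubspace : ∀ x → IsSubspace M (⟨_⟩ M x)
  ⟨⟩-isSubspace x = record
    { resp      = λ y≈z (c , y≈cx) → c , ≈ᴹ-trans (≈ᴹ-sym y≈z) y≈cx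
    ; 0ᴹ∈       = 0# , ≈ᴹ-sym (*ₗ-zeroˡ x)
    ; +ᴹ-closed = λ (c , y≈cx) (d , z≈dx) → c R.+ d , ≈ᴹ-trans (+ᴹ-cong y≈cx z≈dx) (≈ᴹ-sym (*ₗ-distribʳ x c d))
    ; *ₗ-closed = λ a (c , y≈cx) → a R.* c , ≈ᴹ-trans (*ₗ-congˡ y≈cx) (≈ᴹ-sym (*ₗ-assoc a c x))
    }

  x∈⟨x⟩ : ∀ x → x ∈ ⟨_⟩ M x
  x∈⟨x⟩ x = 1# , ≈ᴹ-sym (*ₗ-identityˡ x)

  lincomb-cong : ∀ {d} {c c′ : Vector Carrier d} (b : Vector Carrierᴹ d) → (∀ i → c i ≈ c′ i) → lincomb M c b ≈ᴹ lincomb M c′ b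
  lincomb-cong b c≈c′ = sum-cong-≋ (λ i → *ₗ-congʳ (c≈c′ i))

  lincomb-zero : ∀ {d} {c : Vector Carrier d} (b : Vector Carrierᴹ d) → (∀ i → c i ≈ 0#) → lincomb M c b ≈ᴹ 0ᴹ
  lincomb-zero {d} b c≈0 = ≈ᴹ-trans (sum-cong-≋ (λ i → ≈ᴹ-trans (*ₗ-congʳ (c≈0 i)) (*ₗ-zeroˡ (b i)))) (sum-replicate-zero d)

  lincomb-+ : ∀ {d} (c c′ : Vector Carrier d) (b : Vector Carrierᴹ d) →
    lincomb M (λ i → c i R.+ c′ i) b ≈ᴹ lincomb M c b +ᴹ lincomb M c′ b
  lincomb-+ c c′ b = ≈ᴹ-trans
    (sum-cong-≋ (λ i → *ₗ-distribʳ (b i) (c i) (c′ i)))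
    (∑-distrib-+ (λ i → c i *ₗ b i) (λ i → c′ i *ₗ b i))

  lincomb-injective : ∀ {d} {b : Vector Carrierᴹ d} → Independent b →
    ∀ {c c′} → lincomb M c b ≈ᴹ lincomb M c′ b → ∀ i → c i ≈ c′ i
  lincomb-injective {b = b} independent {c} {c′} cb≈c′b i =
    x∙y⁻¹≈ε⇒x≈y _ _ (independent (λ j → c j - c′ j) difference i)
    where
    difference : lincomb M (λ j → c j - c′ j) b ≈ᴹ 0ᴹ
    difference = GroupProperties.∙-cancelʳ +ᴹ-group (lincomb M c′ b) _ _ (begin
      lincomb M (λ j → c j - c′ j) b +ᴹ lincomb M c′ b    ≈⟨ lincomb-+ _ c′ b ⟨
      lincomb M (λ j → (c j - c′ j) R.+ c′ j) b           ≈⟨ lincomb-cong b (λ j → //-rightDividesˡ (c′ j) (c j)) ⟩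
      lincomb M c b                                       ≈⟨ cb≈c′b ⟩
      lincomb M c′ b                                      ≈⟨ +ᴹ-identityˡ _ ⟨
      0ᴹ +ᴹ lincomb M c′ b                                ∎)

  lincomb∈ : {P : Pred Carrierᴹ p} → IsSubspace M P → ∀ {d} (c : Vector Carrier d) {b : Vector Carrierᴹ d} →
    (∀ i → b i ∈ P) → lincomb M c b ∈ P
  lincomb∈ P {zero}  c b∈P = IsSubspace.0ᴹ∈ P
  lincomb∈ P {suc d} c b∈P = IsSubspace.+ᴹ-closed P (IsSubspace.*ₗ-closed P (c zero) (b∈P zero)) (lincomb∈ P (c ∘ suc) (b∈P ∘ suc))

  -- Counting and decidability over a finite ring

  module _ {k : ℕ} (finite : HasCardinality R.setoid k) where
    private module I = Inverse finite

    _≈?_ : Decidable₂ _≈_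
    _≈?_ = inj⇒≟ (Inverse⇒Injection finite)

    -- Spanning gives the upper bound: a vector is determined by its coordinates, which are packed
    -- into one number below `k ^ d`.
    HasDim⇒AtMost : {P : Pred Carrierᴹ p} {d : ℕ} → HasDim M P d → AtMost ≈ᴹ-setoid P (k ^ d)
    HasDim⇒AtMost {P = P} {d} (b , basis) = record
      { code      = λ x∈P → funToFin (I.to ∘ coords x∈P)
      ; injective = λ x∈P y∈P eq → begin
          _                        ≈⟨ proj₂ (spanning x∈P) ⟩
          lincomb M (coords x∈P) b ≈⟨ lincomb-cong b (λ i → Injection.injective (Inverse⇒Injection finite)
            (≡.trans (≡.sym (finToFun-funToFin (I.to ∘ coords x∈P) i)) (≡.trans (≡.cong (λ n → finToFun n i) eq) (finToFun-funToFin (I.to ∘ coords y∈P) i)))) ⟩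
          lincomb M (coords y∈P) b ≈⟨ proj₂ (spanning y∈P) ⟨
          _                        ∎
      }
      where
      open IsBasis basis
      coords : ∀ {x} → x ∈ P → Vector Carrier d
      coords x∈P = proj₁ (spanning x∈P)

    -- Distinct coefficient vectors give distinct combinations. The family need not be a basis of
    -- `P`, because `⊆-full-dimension` applies this before the family is known to span.
    independent⇒AtLeast : {P : Pred Carrierᴹ p} → IsSubspace M P → ∀ {d} {b : Vector Carrierᴹ d} →
      (∀ i → b i ∈ P) → Independent b → AtLeast ≈ᴹ-setoid P (k ^ d)
    independent⇒AtLeast P {d} {b} b∈P independent = record
      { element   = λ n → lincomb M (coefficients n) b
      ; contained = λ n → lincomb∈ P (coefficients n) b∈P
      ; injective = λ {n} {n′} eq → ≡.trans (≡.sym (funToFin-finToFin {d} n)) (≡.trans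
          (funToFin-cong (λ i → ≡.trans (≡.sym (I.strictlyInverseˡ _)) (≡.trans (I.to-cong (lincomb-injective independent eq i)) (I.strictlyInverseˡ _))))
          (funToFin-finToFin {d} n′))
      }
      where
      coefficients : Fin (k ^ d) → Vector Carrier d
      coefficients n = I.from ∘ finToFun n

      -- The coefficient functions are only known to agree pointwise, so plain congruence does not
      -- apply.
      funToFin-cong : ∀ {d} {f g : Fin d → Fin k} → (∀ i → f i ≡ g i) → funToFin f ≡ funToFin g
      funToFin-cong {zero}  f≗g = ≡.refl
      funToFin-cong {suc d} f≗g = ≡.cong₂ combine (f≗g zero) (funToFin-cong (f≗g ∘ suc))

    HasDim⇒AtLeast : {P : Pred Carrierᴹ p} → IsSubspace M P → ∀ {d} → HasDim M P d → AtLeast ≈ᴹ-setoid P (k ^ d)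
    HasDim⇒AtLeast P (b , basis) = independent⇒AtLeast P contained independent
      where open IsBasis basis

    module _ {n : ℕ} (dimension : HasDim M Whole n) where

      -- A vector vanishes exactly when its coordinates do, and equality of scalars in a finite ring
      -- is decidable.
      ≈0ᴹ? : Decidable (_≈ᴹ 0ᴹ)
      ≈0ᴹ? x = map′
        (λ c≈0 → ≈ᴹ-trans x≈cb (lincomb-zero b c≈0))
        (λ x≈0 → independent c (≈ᴹ-trans (≈ᴹ-sym x≈cb) x≈0))
        (all? (λ i → c i ≈? 0#))
        where
        b = proj₁ dimension
        open IsBasis (proj₂ dimension)
        c = proj₁ (spanning {x} tt)
        x≈cb = proj₂ (spanning {x} tt)

      ∈⟨_⟩? : ∀ x → Decidable (⟨_⟩ M x)
      ∈⟨ x ⟩? y = map′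
        (λ (i , y-cx≈0) → I.from i , GroupProperties.x∙y⁻¹≈ε⇒x≈y +ᴹ-group _ _ y-cx≈0)
        (λ (c , y≈cx) → I.to c , GroupProperties.x≈y⇒x∙y⁻¹≈ε +ᴹ-group (≈ᴹ-trans y≈cx (*ₗ-congʳ (R.sym (I.strictlyInverseʳ c)))))
        (any? (λ i → ≈0ᴹ? (y +ᴹ -ᴹ (I.from i *ₗ x))))

-- Vector spaces over a finite field

^-*-^-monoʳ-< : ∀ {k} d {m n} → 1 < k → m < n → k ^ d * k ^ m < k ^ d * k ^ n
^-*-^-monoʳ-< {k} d {m} {n} 1<k m<n = begin-strict
  k ^ d * k ^ m  ≡⟨ ^-distribˡ-+-* k d m ⟨
  k ^ (d + m)    <⟨ ^-monoʳ-< k 1<k (+-monoʳ-< d m<n) ⟩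
  k ^ (d + n)    ≡⟨ ^-distribˡ-+-* k d n ⟩
  k ^ d * k ^ n  ∎
  where open ≤-Reasoning

module _ (𝕂 : Field ℓ) {k : ℕ} (finite : HasCardinality (Field.setoid 𝕂) k) where
  open Field 𝕂 using (0≉1)

  1<cardinality : 1 < k
  1<cardinality = distinct⇒1< (λ eq → 0≉1 (Injection.injective (Inverse⇒Injection finite) eq))
    where
    distinct⇒1< : ∀ {k} {i j : Fin k} → ¬ i ≡ j → 1 < k
    distinct⇒1< {suc zero}    {zero} {zero} i≢j = contradiction ≡.refl i≢j
    distinct⇒1< {suc (suc _)}                _   = s<s z<s

module _ (𝕂 : Field ℓ) (M : LeftModule (Field.ring 𝕂) ℓ ℓ) {k : ℕ} (finite : HasCardinality (Field.setoid 𝕂) k) where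
  open Field 𝕂 using (_≈_; 0#; inverse)
  private module 𝕂 = Field 𝕂
  open LeftModule M
  open import Relation.Binary.Reasoning.Setoid ≈ᴹ-setoid

  ∈⟨*ₗ⟩ : ∀ {c} x → ¬ c ≈ 0# → x ∈ ⟨_⟩ M (c *ₗ x)
  ∈⟨*ₗ⟩ {c} x c≉0 = let d , cd≈1 = inverse c c≉0 in d , (begin
    x               ≈⟨ *ₗ-identityˡ x ⟨
    𝕂.1# *ₗ x       ≈⟨ *ₗ-congʳ (𝕂.trans (𝕂.*-comm d c) cd≈1) ⟨
    (d 𝕂.* c) *ₗ x  ≈⟨ *ₗ-assoc d c x ⟩
    d *ₗ (c *ₗ x)   ∎)

  *ₗ-cancel-0ᴹ : ∀ {c x} → ¬ x ≈ᴹ 0ᴹ → c *ₗ x ≈ᴹ 0ᴹ → c ≈ 0#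
  *ₗ-cancel-0ᴹ {c} {x} x≉0 cx≈0 = decidable-stable (_≈?_ M finite c 0#) λ c≉0 →
    let d , x≈dcx = ∈⟨*ₗ⟩ x c≉0 in
    x≉0 (≈ᴹ-trans x≈dcx (≈ᴹ-trans (*ₗ-congˡ cx≈0) (*ₗ-zeroʳ d)))

  ⟨⟩-HasDim : ∀ {x} → ¬ x ≈ᴹ 0ᴹ → HasDim M (⟨_⟩ M x) 1
  ⟨⟩-HasDim {x} x≉0 = x ∷ [] , record
    { contained   = λ { zero → x∈⟨x⟩ M x }
    ; independent = λ { c cx≈0 zero → *ₗ-cancel-0ᴹ x≉0 (≈ᴹ-trans (≈ᴹ-sym (+ᴹ-identityʳ _)) cx≈0) }
    ; spanning    = λ (c , y≈cx) → c ∷ [] , ≈ᴹ-trans y≈cx (≈ᴹ-sym (+ᴹ-identityʳ _))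
    }

  -- In a vanishing combination, `c₁ *ₗ y` is a multiple of `x`. An invertible `c₁` would put `y` on
  -- the line of `x`, so `c₁` vanishes, and then `c₀` does too.
  pair-independent : ∀ {x y} → ¬ x ≈ᴹ 0ᴹ → y ∉ ⟨_⟩ M x → Independent M (x ∷ y ∷ [])
  pair-independent {x} {y} x≉0 y∉⟨x⟩ c cxy≈0 = λ { zero → c₀≈0 ; (suc zero) → c₁≈0 }
    where
    c₀ = c zero
    c₁ = c (suc zero)

    c₀x+c₁y≈0 : c₀ *ₗ x +ᴹ c₁ *ₗ y ≈ᴹ 0ᴹ
    c₀x+c₁y≈0 = ≈ᴹ-trans (+ᴹ-congˡ (≈ᴹ-sym (+ᴹ-identityʳ _))) cxy≈0

    open IsSubspace (⟨⟩-isSubspace M x)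

    c₁y∈⟨x⟩ : c₁ *ₗ y ∈ ⟨_⟩ M x
    c₁y∈⟨x⟩ = resp (≈ᴹ-sym (LeftModuleProperties.inverseʳ-uniqueᴹ M _ _ c₀x+c₁y≈0))
      (-ᴹ-closed M (⟨⟩-isSubspace M x) (*ₗ-closed c₀ (x∈⟨x⟩ M x)))

    c₁≈0 : c₁ ≈ 0#
    c₁≈0 = decidable-stable (_≈?_ M finite c₁ 0#) λ c₁≉0 →
      y∉⟨x⟩ (⟨⟩-⊆ M (⟨⟩-isSubspace M x) c₁y∈⟨x⟩ (∈⟨*ₗ⟩ y c₁≉0))

    c₀≈0 : c₀ ≈ 0#
    c₀≈0 = *ₗ-cancel-0ᴹ x≉0 (begin
      c₀ *ₗ x               ≈⟨ +ᴹ-identityʳ _ ⟨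
      c₀ *ₗ x +ᴹ 0ᴹ         ≈⟨ +ᴹ-congˡ (≈ᴹ-trans (*ₗ-congʳ c₁≈0) (*ₗ-zeroˡ y)) ⟨
      c₀ *ₗ x +ᴹ c₁ *ₗ y    ≈⟨ c₀x+c₁y≈0 ⟩
      0ᴹ                    ∎)

  module _ {n : ℕ} (dimension : HasDim M Whole n) where

    -- For nonzero `x` in `Q`, the pairs from `P` and the line of `x` number at least `k ^ d * k`,
    -- while their sums lie in `Q`, which has at most `k ^ d` elements. So `P` contains a nonzero
    -- multiple of `x`, hence `x` itself.
    ⊆-full-dimension : {P : Pred Carrierᴹ p} {Q : Pred Carrierᴹ r} → IsSubspace M P → IsSubspace M Q → P ⊆ Q →
      ∀ {d} {b : Vector Carrierᴹ d} → (∀ i → b i ∈ P) → Independent M b → HasDim M Q d → Q ⊆ P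
    ⊆-full-dimension {P = P} {Q} P-subspace Q-subspace P⊆Q {d} b∈P independent dimQ {x} x∈Q
      with ≈0ᴹ? M finite dimension x
    -- The zero vector is treated apart because its span does not have `k` elements.
    ... | yes x≈0 = IsSubspace.resp P-subspace (≈ᴹ-sym x≈0) (IsSubspace.0ᴹ∈ P-subspace)
    ... | no  x≉0 = x∈P (∩-escapes +ᴹ-group (\\-closed M P-subspace) (//-closed M (⟨⟩-isSubspace M x))
      (λ y∈P z∈⟨x⟩ → IsSubspace.+ᴹ-closed Q-subspace (P⊆Q y∈P) (⟨⟩-⊆ M Q-subspace x∈Q z∈⟨x⟩))
      (≈0ᴹ? M finite dimension)
      (independent⇒AtLeast M finite P-subspace b∈P independent)
      (HasDim⇒AtLeast M finite (⟨⟩-isSubspace M x) (⟨⟩-HasDim x≉0))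
      (HasDim⇒AtMost M finite dimQ)
      (∩0ᴹ-AtMost M P)
      (^-*-^-monoʳ-< d {0} {1} (1<cardinality 𝕂 finite) z<s))
      where
      x∈P : ∃ (λ y → y ∈ P × y ∈ ⟨_⟩ M x × ¬ y ≈ᴹ 0ᴹ) → x ∈ P
      x∈P (y , y∈P , (c , y≈cx) , y≉0) =
        ⟨⟩-⊆ M P-subspace (IsSubspace.resp P-subspace y≈cx y∈P) (∈⟨*ₗ⟩ x c≉0)
        where
        c≉0 : ¬ c ≈ 0#
        c≉0 c≈0 = y≉0 (≈ᴹ-trans y≈cx (≈ᴹ-trans (*ₗ-congʳ c≈0) (*ₗ-zeroˡ x)))

-- Numerical inequalities for the pigeonhole step

dimension-count : ∀ m n {e h} → 2 ≤ n → e ≤ h → m * n + e < ((n ∸ 2) * m + h + 1) + m * 2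
-- Writing the dimension as `2 + n` makes the truncated subtraction compute. For `e` equal to `h`
-- the two sides differ by exactly the `1` in the dimension of `U`.
dimension-count m (suc (suc n)) {e} {h} (s≤s (s≤s _)) e≤h = begin-strict
  m * (2 + n) + e            ≤⟨ +-monoʳ-≤ (m * (2 + n)) e≤h ⟩
  m * (2 + n) + h            <⟨ ≤-reflexive (solve 3 (λ m n h → con 1 :+ (m :* (con 2 :+ n) :+ h) := n :* m :+ h :+ con 1 :+ m :* con 2) ≡.refl m n h) ⟩
  (n * m + h + 1) + m * 2    ∎
  where
  open ≤-Reasoning
  open +-*-Solver

cardinality-count : ∀ {q} m n {e h} → 1 < q → 2 ≤ n → e ≤ h →
  (q ^ m) ^ n * q ^ e < q ^ ((n ∸ 2) * m + h + 1) * (q ^ m) ^ 2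
cardinality-count {q} m n {e} {h} 1<q 2≤n e≤h = begin-strict
  (q ^ m) ^ n * q ^ e                             ≡⟨ ≡.cong (_* q ^ e) (^-*-assoc q m n) ⟩
  q ^ (m * n) * q ^ e                             ≡⟨ ^-distribˡ-+-* q (m * n) e ⟨
  q ^ (m * n + e)                                 <⟨ ^-monoʳ-< q 1<q (dimension-count m n 2≤n e≤h) ⟩
  q ^ ((n ∸ 2) * m + h + 1 + m * 2)               ≡⟨ ^-distribˡ-+-* q ((n ∸ 2) * m + h + 1) (m * 2) ⟩
  q ^ ((n ∸ 2) * m + h + 1) * q ^ (m * 2)         ≡⟨ ≡.cong (q ^ ((n ∸ 2) * m + h + 1) *_) (^-*-assoc q m 2) ⟨
  q ^ ((n ∸ 2) * m + h + 1) * (q ^ m) ^ 2         ∎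
  where open ≤-Reasoning

-- Blocking and cutting properties of the linear set

theorem7p5 : {ℓ : Level} (q m n h : ℕ) → IsPrimePower q → 1 ≤ m → 3 ≤ n →
    (E : FieldExtension ℓ) →
    HasCardinality (FieldExtension.F.setoid E) q →
    HasCardinality (FieldExtension.K.setoid E) (q ^ m) →
    (X : LeftModule (FieldExtension.K.ring E) ℓ ℓ) →
    HasDim X Whole n →
    (U : Pred (LeftModule.Carrierᴹ X) ℓ) →
    IsSubspace (restrictScalars E X) U →
    IsEvasive E X (points E X) h U →
    HasDim (restrictScalars E X) U ((n ∸ 2) * m + h + 1) →
    IsLinear2CuttingBlockingSet E X n (linearSet E X U)
theorem7p5 {ℓ} q m n h _ _ 3≤n E |F|≡q |K|≡q^m X dimX U U-subspace evasive dimU = record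
  { isLinearSet   = U , U-subspace , ≐-refl
  ; isBlockingSet = record
    { 0<r        = m<n⇒0<n∸m 3≤n
    ; r<n        = ∸-monoʳ-< z<s (<⇒≤ 3≤n)
    ; isPointSet = record
      { resp      = λ P≐Q (u , u∈U , u≉0 , P≐⟨u⟩) → u , u∈U , u≉0 , ≐-trans (≐-sym P≐Q) P≐⟨u⟩
      ; dimension = λ (u , _ , u≉0 , P≐⟨u⟩) → ≐-IsSubspaceOfDim X (≐-sym P≐⟨u⟩)
          (⟨⟩-isSubspace X u , ⟨⟩-HasDim K X |K|≡q^m u≉0)
      }
    -- Blocking concerns subspaces of dimension `n ∸ (n ∸ 2)`, which equals `2` since `2 ≤ n`.
    ; blocks     = λ {S} S-dim → blocks (≡.subst (λ k → IsSubspaceOfDim X k S) (m∸[m∸n]≡n (<⇒≤ 3≤n)) S-dim)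
    }
  ; isCutting     = λ S-plane S′-plane → mk⇔
      (planes-agree S-plane S′-plane)
      (λ (S⊆S′ , _) (P∈L , P⊆S) → P∈L , λ x∈P → S⊆S′ (P⊆S x∈P))
  }
  where
  open FieldExtension E using () renaming (base to F; top to K)
  open LeftModule X

  X∣F : LeftModule (Field.ring F) ℓ ℓ
  X∣F = restrictScalars E X

  IsPlane : Pred Carrierᴹ ℓ → Set ℓ
  IsPlane = IsSubspaceOfDim X 2

  module _ {S : Pred Carrierᴹ ℓ} (S-plane : IsPlane S) where

    -- `U` is a subspace over the small field and `S` over the large one, but both are subgroups of
    -- the same additive group, so `∩-escapes` applies with all of `X` as the set of sums.
    U∩S-escapes : {W : Pred Carrierᴹ ℓ} → Decidable W → ∀ {e} → AtMost ≈ᴹ-setoid (U ∩ W) (q ^ e) → e ≤ h →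
      ∃ λ u → u ∈ U × u ∈ S × u ∉ W
    U∩S-escapes W? U∩W≤q^e e≤h =
      ∩-escapes +ᴹ-group (\\-closed X∣F U-subspace) (//-closed X (proj₁ S-plane)) (λ _ _ → tt) W?
        (HasDim⇒AtLeast X∣F |F|≡q U-subspace dimU)
        (HasDim⇒AtLeast X |K|≡q^m (proj₁ S-plane) (proj₂ S-plane))
        (HasDim⇒AtMost X |K|≡q^m dimX)
        U∩W≤q^e
        (cardinality-count m n (1<cardinality F |F|≡q) (<⇒≤ 3≤n) e≤h)

    nonzero∈U∩S : ∃ λ u → u ∈ U × u ∈ S × ¬ u ≈ᴹ 0ᴹ
    nonzero∈U∩S = U∩S-escapes (≈0ᴹ? X |K|≡q^m dimX) (∩0ᴹ-AtMost X U) z≤n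

    outside⟨⟩∈U∩S : ∀ {x} → ¬ x ≈ᴹ 0ᴹ → ∃ λ u → u ∈ U × u ∈ S × u ∉ ⟨_⟩ X x
    -- Evasiveness at the point of `x` supplies the exponent `e ≤ h` that bounds the number of
    -- elements of `U` on this point.
    outside⟨⟩∈U∩S {x} x≉0 = let e , U∩⟨x⟩-dim , e≤h = evasive (x , x≉0 , ≐-refl) in
      U∩S-escapes (∈⟨_⟩? X |K|≡q^m dimX x) (HasDim⇒AtMost X∣F |F|≡q U∩⟨x⟩-dim) e≤h

    blocks : ∃ λ P → P ∈ linearSet E X U × P ⊆ S
    blocks = let u , u∈U , u∈S , u≉0 = nonzero∈U∩S in
      ⟨_⟩ X u , (u , u∈U , u≉0 , ≐-refl) , ⟨⟩-⊆ X (proj₁ S-plane) u∈S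

    -- Passes from points to vectors: the point spanned by `u` belongs to the linear set and lies in
    -- `S`, hence in `S′`, and it contains `u`.
    points-⊆ : ∀ {S′} → pointsIn E X (linearSet E X U) S ⊆ pointsIn E X (linearSet E X U) S′ →
      ∀ {u} → u ∈ U → u ∈ S → ¬ u ≈ᴹ 0ᴹ → u ∈ S′
    points-⊆ points⊆ {u} u∈U u∈S u≉0 =
      proj₂ (points⊆ ((u , u∈U , u≉0 , ≐-refl) , ⟨⟩-⊆ X (proj₁ S-plane) u∈S)) (x∈⟨x⟩ X u)

  planes-agree : ∀ {S S′} → IsPlane S → IsPlane S′ →
    pointsIn E X (linearSet E X U) S ⊆ pointsIn E X (linearSet E X U) S′ → S ≐ S′
  planes-agree {S} {S′} S-plane S′-plane points⊆
    with u , u∈U , u∈S , u≉0 ← nonzero∈U∩S S-plane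
    with v , v∈U , v∈S , v∉⟨u⟩ ← outside⟨⟩∈U∩S S-plane u≉0 =
      (λ x∈S → proj₂ (S⊆S∩S′ x∈S)) , (λ x∈S′ → proj₁ (S′⊆S∩S′ x∈S′))
    where
    v≉0 : ¬ v ≈ᴹ 0ᴹ
    v≉0 v≈0 = v∉⟨u⟩ (resp (≈ᴹ-sym v≈0) 0ᴹ∈)
      where open IsSubspace (⟨⟩-isSubspace X u)

    S∩S′-subspace : IsSubspace X (S ∩ S′)
    S∩S′-subspace = ∩-isSubspace X (proj₁ S-plane) (proj₁ S′-plane)

    uv∈S∩S′ : ∀ i → (u ∷ v ∷ []) i ∈ S ∩ S′
    uv∈S∩S′ zero       = u∈S , points-⊆ S-plane points⊆ u∈U u∈S u≉0
    uv∈S∩S′ (suc zero) = v∈S , points-⊆ S-plane points⊆ v∈U v∈S v≉0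

    -- The independent vectors `u` and `v` make `S ∩ S′` fill any plane containing it; both `S` and
    -- `S′` are such planes.
    plane-⊆ : ∀ {Q} → IsPlane Q → S ∩ S′ ⊆ Q → Q ⊆ S ∩ S′
    plane-⊆ (Q-subspace , dimQ) S∩S′⊆Q = ⊆-full-dimension K X |K|≡q^m dimX
      S∩S′-subspace Q-subspace S∩S′⊆Q uv∈S∩S′ (pair-independent K X |K|≡q^m u≉0 v∉⟨u⟩) dimQ

    S⊆S∩S′ : S ⊆ S ∩ S′
    S⊆S∩S′ = plane-⊆ S-plane proj₁

    S′⊆S∩S′ : S′ ⊆ S ∩ S′
    S′⊆S∩S′ = plane-⊆ S′-plane proj₂
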